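{- There is an online-LOCAL algorithm that finds a proper $3$-coloring of any bipartite graph with locality $O(\log n)$, where $n$ is the number of nodes.
   Context: Graphs are simple, undirected and finite; $n$ denotes the number of nodes and is known to the algorithm; $B(v,T)$ denotes the set of nodes within distance $T$ of $v$, and $G[U]$ the subgraph induced by $U$. Online-LOCAL model with locality $T=T(n)$: an adversary chooses an ordering $v_1,v_2,\dots,v_n$ of the nodes of the input graph $G$ and reveals them one at a time. Let $G_i = G\bigl[\bigcup_{j=1}^{i} B(v_j,T)\bigr]$. When $v_i$ is presented, the algorithm (which has unbounded memory of everything seen so far) must irrevocably choose the output label of $v_i$ based only on $v_1,\dots,v_i$ and $G_i$. The algorithm solves a problem with locality $T$ if for every input graph of the family and every adversarial ordering, the resulting labeling is a feasible solution. A proper $3$-coloring assigns each node a color in $\{0,1,2\}$ so that adjacent nodes receive different colors. -}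

module Defs where

open import Data.Nat using (ℕ; zero; suc; _*_; _≤_)
open import Data.Nat.Logarithm using (⌊log₂_⌋)
open import Data.Bool using (Bool; true; false; _∧_; _∨_)
open import Data.Fin using (Fin; _≤?_)
open import Data.Fin.Properties using (_≟_)
open import Data.List using (List; map; filter; allFin)
open import Data.Bool.ListAction using (any)
open import Data.Product using (Σ; _×_; ∃-syntax)
open import Relation.Nullary using (¬_)
open import Relation.Nullary.Decidable using (⌊_⌋)
open import Relation.Binary.PropositionalEquality using (_≡_)
open import Function.Definitions using (Injective)

record Graph (n : ℕ) : Set where
  field
    adj     : Fin n → Fin n → Bool
    adj-sym : ∀ u w → adj u w ≡ adj w u
    irrefl  : ∀ u → adj u u ≡ false
open Graph public

Bipartite : ∀ {n} → Graph n → Set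
Bipartite {n} G = Σ (Fin n → Bool) λ side →
  ∀ u w → adj G u w ≡ true → ¬ (side u ≡ side w)

inBall : ∀ {n} → Graph n → ℕ → Fin n → Fin n → Bool
inBall G zero    v w = ⌊ v ≟ w ⌋
inBall {n} G (suc T) v w =
  inBall G T v w ∨ any (λ x → inBall G T v x ∧ adj G x w) (allFin n)

-- An online-LOCAL algorithm: given n, the revealed nodes v_1,…,v_i (in
-- order, v_i last) and the graph G_i (its node set as a Boolean
-- membership predicate, and its adjacency, i.e. adjacency of G restricted
-- to that node set), it outputs the color of v_i.
Algorithm : Set
Algorithm = (n : ℕ) → List (Fin n) → (Fin n → Bool) → (Fin n → Fin n → Bool) → Fin 3

-- The adversarial ordering is a bijection σ : Fin n → Fin n, v_{i+1} = σ i.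
-- prefix σ i = [v_1, …, v_{i+1}] = [σ 0, …, σ i].
prefix : ∀ {n} → (Fin n → Fin n) → Fin n → List (Fin n)
prefix {n} σ i = map σ (filter (λ j → j ≤? i) (allFin n))

visible : ∀ {n} → Graph n → ℕ → List (Fin n) → Fin n → Bool
visible G T vs w = any (λ v → inBall G T v w) vs

visibleAdj : ∀ {n} → Graph n → ℕ → List (Fin n) → Fin n → Fin n → Bool
visibleAdj G T vs u w = visible G T vs u ∧ visible G T vs w ∧ adj G u w

output : Algorithm → (ℕ → ℕ) → ∀ {n} → Graph n → (Fin n → Fin n) → Fin n → Fin 3
output A T {n} G σ i =
  A n (prefix σ i) (visible G (T n) (prefix σ i)) (visibleAdj G (T n) (prefix σ i))

Solves3ColBipartite : Algorithm → (ℕ → ℕ) → Set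
Solves3ColBipartite A T =
  ∀ n (G : Graph n) → Bipartite G →
  (σ : Fin n → Fin n) → Injective _≡_ _≡_ σ →
  ∀ i j → adj G (σ i) (σ j) ≡ true → ¬ (output A T G σ i ≡ output A T G σ j)

IsOLog : (ℕ → ℕ) → Set
IsOLog T = ∃[ C ] ∃[ n₀ ] (∀ n → n₀ ≤ n → T n ≤ C * ⌊log₂ n ⌋)

{-# OPTIONS --safe #-}
module Submission where

-- A 3-coloring of a bipartite graph is obtained by reducing modulo 3 a height
-- function whose values at adjacent nodes differ by exactly 1.  Every revealed
-- node gets a height, and revealed nodes at distance at most T are put into the
-- same group; within a group, heights are 1-Lipschitz for the graph distance and
-- their parity follows the bipartition.  A new node v merges the groups near it.
-- These fall into two classes according to the parity they would impose at v;
-- the class with fewer nodes is lifted by 3, which flips the parity but keeps the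
-- colors, and then v gets the least height that is Lipschitz and of the right
-- parity.  A lifted group at least doubles in size, so heights never exceed
-- 1 + 3 log₂ n = T, and hence the Lipschitz condition is vacuous beyond distance T.

open import Defs
open import Data.Nat using (ℕ)
open import Data.Product using (Σ; _×_)
open import Data.Bool using (Bool; true; false; not; _xor_; T)
open import Data.Bool.Properties using (T-≡; T-∧; T-∨; xor-assoc; xor-comm; xor-identityʳ; not-distribˡ-xor; not-distribʳ-xor; not-involutive; ¬-not; not-¬)
import Data.Bool.Properties as Bool
open import Data.Fin using (Fin; zero; suc)
open import Data.Fin.Properties using (_≟_; <-cmp)
import Data.Fin as Fin
open import Data.List using (List; []; _∷_; [_]; _++_; _∷ʳ_; map; filter; concat; concatMap; foldl; length; upTo; allFin; tabulate)
open import Data.List.Extrema.Nat using (max; ⊥≤max; xs≤max; argmax-sel)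
open import Data.List.Properties using (foldl-++; foldl-∷ʳ; filter-≐; filter-none; length-filter; length-map; map-++; map-id; map-tabulate; map-cong-local)
open import Data.List.Membership.Propositional using (_∈_; find; lose)
open import Data.List.Membership.Propositional.Properties using (∈-map⁺; ∈-map⁻; ∈-filter⁺; ∈-filter⁻; ∈-concatMap⁺; ∈-concatMap⁻; ∈-upTo⁺; ∈-upTo⁻; ∈-allFin; ∈-length)
import Data.List.Relation.Unary.All as All
import Data.List.Relation.Unary.All.Properties as All
open import Data.List.Relation.Unary.Any using (Any; here; there; any?)
open import Data.List.Relation.Unary.Any.Properties using (any⁺)
open import Data.Nat using (zero; suc; _+_; _*_; _^_; _∸_; _≤_; _<_; z≤n; s≤s; s≤s⁻¹)
import Data.Nat as ℕ
open import Data.Nat.Logarithm using (⌊log₂_⌋; ⌊log₂⌋-mono-≤; ⌊log₂[2^n]⌋≡n)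
open import Data.Nat.Properties hiding (_≟_; <-cmp)
open import Data.Product using (∃-syntax; _,_; proj₁; proj₂)
open import Data.Sum using (_⊎_; inj₁; inj₂)
import Data.Sum as Sum
open import Function using (_∘_; id)
open import Function.Bundles using (Equivalence)
open import Relation.Binary.Definitions using (tri<; tri≈; tri>)
open import Relation.Binary.PropositionalEquality using (_≡_; _≢_; refl; sym; trans; cong; cong₂; subst; subst₂; module ≡-Reasoning)
open import Relation.Nullary using (¬_; Dec; yes; no; contradiction)
open import Relation.Nullary.Decidable using (_⊎-dec_; _×-dec_; fromWitness)
open import Relation.Unary using (Decidable)

-- Parity of natural numbers and colors modulo 3

odd : ℕ → Bool
odd zero    = false
odd (suc m) = not (odd m)

odd-+ : ∀ m k → odd (m + k) ≡ odd m xor odd k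
odd-+ zero    k = refl
odd-+ (suc m) k = trans (cong not (odd-+ m k)) (not-distribˡ-xor (odd m) (odd k))

odd-∸ : ∀ {m k} → k ≤ m → odd (m ∸ k) ≡ odd (m + k)
odd-∸ {m} z≤n = cong odd (sym (+-identityʳ m))
odd-∸ {suc m} {suc k} (s≤s k≤m) = trans (odd-∸ k≤m)
  (trans (sym (not-involutive _)) (cong (not ∘ odd) (sym (+-suc m k))))

bit : Bool → ℕ
bit false = 0
bit true  = 1

odd-bit : ∀ b → odd (bit b) ≡ b
odd-bit false = refl
odd-bit true  = refl

bit≤1 : ∀ b → bit b ≤ 1
bit≤1 false = z≤n
bit≤1 true  = s≤s z≤n

bit-odd≤ : ∀ m → bit (odd m) ≤ m
bit-odd≤ zero    = z≤n
bit-odd≤ (suc m) = ≤-trans (bit≤1 _) (s≤s z≤n)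

xor-shuffle : ∀ a b c → a xor (b xor c) ≡ (a xor c) xor b
xor-shuffle a b c = trans (cong (a xor_) (xor-comm b c)) (sym (xor-assoc a c b))

xor-cancelʳ : ∀ c {a b} → a xor c ≡ b xor c → a ≡ b
xor-cancelʳ false {a} {b} p = trans (sym (xor-identityʳ a)) (trans p (xor-identityʳ b))
xor-cancelʳ true {false} {false} p = refl
xor-cancelʳ true {true}  {true}  p = refl

xor-cancelˡ : ∀ a {b c} → a xor b ≡ a xor c → b ≡ c
xor-cancelˡ a {b} {c} p = xor-cancelʳ a (trans (xor-comm b a) (trans p (xor-comm a c)))

color : ℕ → Fin 3
color 0                   = zero
color 1                   = suc zero
color 2                   = suc (suc zero)
color (suc (suc (suc h))) = color h

color-suc≢ : ∀ h → color h ≢ color (suc h)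
color-suc≢ 0 ()
color-suc≢ 1 ()
color-suc≢ 2 ()
color-suc≢ (suc (suc (suc h))) p = color-suc≢ h p

-- Numbers at most 1 apart and of different parity are consecutive, and consecutive numbers have
-- different residues modulo 3.
color-separates : ∀ {h k} → h ≤ suc k → k ≤ suc h → odd h ≢ odd k → color h ≢ color k
color-separates {h} {k} h≤ k≤ h≢k with ℕ.compare h k
... | ℕ.equal _            = contradiction refl h≢k
... | ℕ.less _ zero        = subst (λ m → color h ≢ color (suc m)) (sym (+-identityʳ h)) (color-suc≢ h)
... | ℕ.less _ (suc j)     = contradiction (+-cancelˡ-≤ h _ _ (subst₂ _≤_ (sym (+-suc h (suc j))) (sym (+-comm h 1)) k≤))
                               λ where (s≤s ())
... | ℕ.greater _ zero     = λ eq → color-suc≢ k (trans (sym eq) (cong (color ∘ suc) (+-identityʳ k)))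
... | ℕ.greater _ (suc j)  = contradiction (+-cancelˡ-≤ k _ _ (subst₂ _≤_ (sym (+-suc k (suc j))) (sym (+-comm k 1)) h≤))
                               λ where (s≤s ())

-- Counting list elements with filters

module _ {A C : Set} {P : A → Set} {R : C → Set}
         (P? : Decidable P) (R? : Decidable R) (f : A → C) where

  length-filter-map-≤ : ∀ xs → (∀ {x} → x ∈ xs → P x → R (f x)) →
                        length (filter P? xs) ≤ length (filter R? (map f xs))
  length-filter-map-≤ []       _ = z≤n
  length-filter-map-≤ (x ∷ xs) P⇒R
    with P? x | R? (f x) | length-filter-map-≤ xs (P⇒R ∘ there)
  ... | yes _  | yes _  | ih = s≤s ih
  ... | yes px | no ¬r  | _  = contradiction (P⇒R (here refl) px) ¬r
  ... | no _   | yes _  | ih = m≤n⇒m≤1+n ih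
  ... | no _   | no _   | ih = ih

  -- Since no element satisfies both `P` and `Q`, none is counted twice. This is what makes the
  -- sizes of the two merged classes add up.
  length-filter-disjoint-≤ : ∀ {Q : A → Set} (Q? : Decidable Q) xs → (∀ {x} → x ∈ xs → P x → ¬ Q x) →
    (∀ {x} → x ∈ xs → P x → R (f x)) → (∀ {x} → x ∈ xs → Q x → R (f x)) →
    length (filter P? xs) + length (filter Q? xs) ≤ length (filter R? (map f xs))
  length-filter-disjoint-≤ Q? []       _ _ _ = z≤n
  length-filter-disjoint-≤ Q? (x ∷ xs) P⇒¬Q P⇒R Q⇒R
    with P? x | Q? x | R? (f x)
       | length-filter-disjoint-≤ Q? xs (P⇒¬Q ∘ there) (P⇒R ∘ there) (Q⇒R ∘ there)
  ... | yes px | yes qx | _     | _  = contradiction qx (P⇒¬Q (here refl) px)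
  ... | yes px | _      | no ¬r | _  = contradiction (P⇒R (here refl) px) ¬r
  ... | _      | yes qx | no ¬r | _  = contradiction (Q⇒R (here refl) qx) ¬r
  ... | yes _  | no _   | yes _ | ih = s≤s ih
  ... | no _   | yes _  | yes _ | ih = ≤-trans (≤-reflexive (+-suc _ _)) (s≤s ih)
  ... | no _   | no _   | yes _ | ih = m≤n⇒m≤1+n ih
  ... | no _   | no _   | no _  | ih = ih

length-filter-∷-≤ : ∀ {A : Set} {P : A → Set} (P? : Decidable P) x xs →
                    length (filter P? xs) ≤ length (filter P? (x ∷ xs))
length-filter-∷-≤ P? x xs with P? x
... | yes _ = n≤1+n _
... | no _  = ≤-refl

lighter : (m : Bool → ℕ) → ∃[ b ] m b ≤ m (not b)
lighter m with ≤-total (m true) (m false)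
... | inj₁ p = true , p
... | inj₂ p = false , p

-- The algorithm

-- `label` names the group of the node. Later steps may revise `height`, but only by multiples of 3.
record Entry (n : ℕ) : Set where
  constructor entry
  field
    node   : Fin n
    label  : ℕ
    height : ℕ
open Entry

-- A pair (x , ℓ) records that some walk of length exactly ℓ ends at x.
Ball : ℕ → Set
Ball n = List (Fin n × ℕ)

groupSize : ∀ {n} → List (Entry n) → ℕ → ℕ
groupSize s a = length (filter (λ e → label e ℕ.≟ a) s)

module Step {n} (B : Ball n) (s : List (Entry n)) where

  -- Labels in use stay below the number of entries, so this one names a new group.
  fresh : ℕ
  fresh = length s

  -- Group a reaches the new node with parity b: one of its heights, continued
  -- alternately along a walk, would give the new node a height of parity b.
  Touch : Bool → ℕ → Set
  Touch b a = Any (λ e → label e ≡ a ×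
                         Any (λ p → proj₁ p ≡ node e × odd (height e + proj₂ p) ≡ b) B) s

  abstract
    touch? : ∀ b a → Dec (Touch b a)
    touch? b a = any? (λ e → (label e ℕ.≟ a) ×-dec
      any? (λ p → (proj₁ p ≟ node e) ×-dec (odd (height e + proj₂ p) Bool.≟ b)) B) s

  -- Counts all members of the touching groups, including those far from the new node.
  weight : Bool → ℕ
  weight b = length (filter (λ e → touch? b (label e)) s)

  abstract
    shifted : Bool
    shifted = proj₁ (lighter weight)

    shifted-lighter : weight shifted ≤ weight (not shifted)
    shifted-lighter = proj₂ (lighter weight)

    -- A function of the label alone, so a group moves rigidly and height differences inside it are
    -- kept.
    lift : ℕ → ℕ
    lift a with touch? shifted a
    ... | yes _ = 3
    ... | no _  = 0

    relabel : ℕ → ℕ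
    relabel a with touch? false a ⊎-dec touch? true a
    ... | yes _ = fresh
    ... | no _  = a

    lift-view : ∀ a → (Touch shifted a × lift a ≡ 3) ⊎ (¬ Touch shifted a × lift a ≡ 0)
    lift-view a with touch? shifted a
    ... | yes t = inj₁ (t , refl)
    ... | no ¬t = inj₂ (¬t , refl)

    relabel-view : ∀ a → ((∃[ b ] Touch b a) × relabel a ≡ fresh) ⊎
                         ((∀ b → ¬ Touch b a) × relabel a ≡ a)
    relabel-view a with touch? false a ⊎-dec touch? true a
    ... | yes (inj₁ t) = inj₁ ((false , t) , refl)
    ... | yes (inj₂ t) = inj₁ ((true , t) , refl)
    ... | no ¬t = inj₂ ((λ { false → ¬t ∘ inj₁ ; true → ¬t ∘ inj₂ }) , refl)

  Touch⇒fresh : ∀ {b a} → Touch b a → relabel a ≡ fresh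
  Touch⇒fresh {b} {a} t with relabel-view a
  ... | inj₁ (_ , eq) = eq
  ... | inj₂ (¬t , _) = contradiction t (¬t b)

  color-lift : ∀ a h → color (lift a + h) ≡ color h
  color-lift a h with lift-view a
  ... | inj₁ (_ , eq) = cong (λ k → color (k + h)) eq
  ... | inj₂ (_ , eq) = cong (λ k → color (k + h)) eq

  update : Entry n → Entry n
  update e = entry (node e) (relabel (label e)) (lift (label e) + height e)

  updated : List (Entry n)
  updated = map update s

  -- The lower bounds that the Lipschitz condition puts on the new height, one for each walk to the
  -- node of `e`.
  descents : Entry n → List ℕ
  descents e = map (λ p → height e ∸ proj₂ p) (filter (λ p → proj₁ p ≟ node e) B)

  ∈-descents⁻ : ∀ {h} → h ∈ concatMap descents updated →
    ∃[ e ] ∃[ ℓ ] e ∈ updated × (node e , ℓ) ∈ B × h ≡ height e ∸ ℓ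
  ∈-descents⁻ h∈ with find (∈-concatMap⁻ descents {xs = updated} h∈)
  ... | e , e∈ , h∈e with ∈-map⁻ (λ p → height e ∸ proj₂ p) h∈e
  ... | (x , ℓ) , p∈ , eq with ∈-filter⁻ (λ p → proj₁ p ≟ node e) {xs = B} p∈
  ... | p∈B , refl = e , ℓ , e∈ , p∈B , eq

  abstract
    -- After the lift every touching group asks for parity `not shifted`; the default value is the
    -- least number of that parity.
    newHeight : ℕ
    newHeight = max (bit (not shifted)) (concatMap descents updated)

    newHeight-sel : newHeight ≡ bit (not shifted) ⊎
      (∃[ e ] ∃[ ℓ ] e ∈ updated × (node e , ℓ) ∈ B × newHeight ≡ height e ∸ ℓ)
    newHeight-sel = Sum.map₂ ∈-descents⁻ (argmax-sel id _ (concatMap descents updated))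

    bit≤newHeight : bit (not shifted) ≤ newHeight
    bit≤newHeight = ⊥≤max _ (concatMap descents updated)

    descent≤newHeight : ∀ {e ℓ} → e ∈ updated → (node e , ℓ) ∈ B → height e ∸ ℓ ≤ newHeight
    descent≤newHeight {e} e∈ p∈ = All.lookup (xs≤max (bit (not shifted)) _)
      (∈-concatMap⁺ descents (lose e∈
        (∈-map⁺ (λ p → height e ∸ proj₂ p) (∈-filter⁺ (λ p → proj₁ p ≟ node e) p∈ refl))))

  step : Fin n → List (Entry n)
  step v = entry v fresh newHeight ∷ updated

open Step using (step)

run : ∀ {n} → (Fin n → Ball n) → List (Entry n) → List (Fin n) → List (Entry n)
run near = foldl (λ s v → step (near v) s v)

module _ {n} (A : Fin n → Fin n → Bool) where

  neighbors : Fin n → List (Fin n)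
  neighbors x = filter (λ y → A x y Bool.≟ true) (allFin n)

  walkEnds : ℕ → Fin n → List (Fin n)
  walkEnds zero    v = [ v ]
  walkEnds (suc ℓ) v = concatMap neighbors (walkEnds ℓ v)

  -- Walk lengths stand in for distances: in a bipartite graph a longer walk to the same node has a
  -- length of the same parity and gives only a weaker Lipschitz bound.
  walksFrom : ℕ → Fin n → Ball n
  walksFrom r v = concatMap (λ ℓ → map (_, ℓ) (walkEnds ℓ v)) (upTo (suc r))

-- Bounds a starting height of at most 1 followed by at most `⌊log₂ n ⌋` lifts by 3. Being at least
-- 1, it also covers single edges.
radius : ℕ → ℕ
radius n = 1 + 3 * ⌊log₂ n ⌋

headColor : ∀ {n} → List (Entry n) → Fin 3
headColor []      = zero
headColor (e ∷ _) = color (height e)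

-- Instead of storing a state, each call replays all earlier steps on the graph visible now. The
-- replays agree with each other by `walksFrom-visible`.
algorithm : Algorithm
algorithm n vs _ A = headColor (run (walksFrom A (radius n)) [] vs)

radius-IsOLog : IsOLog radius
-- From `2 ≤ n` on, the logarithm is at least 1 and absorbs the summand 1.
radius-IsOLog = 4 , 2 , λ n 2≤n → +-monoˡ-≤ (3 * ⌊log₂ n ⌋) (⌊log₂⌋-mono-≤ 2≤n)

-- Walks

data Walk {n} (G : Graph n) : ℕ → Fin n → Fin n → Set where
  nil  : ∀ {x} → Walk G 0 x x
  snoc : ∀ {ℓ x y z} → Walk G ℓ x y → adj G y z ≡ true → Walk G (suc ℓ) x z

module _ {n} {G : Graph n} where

  walk-trans : ∀ {k ℓ x y z} → Walk G k x y → Walk G ℓ y z → Walk G (ℓ + k) x z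
  walk-trans p nil        = p
  walk-trans p (snoc q e) = snoc (walk-trans p q) e

  walk-sym : ∀ {ℓ x y} → Walk G ℓ x y → Walk G ℓ y x
  walk-sym nil = nil
  walk-sym (snoc {ℓ} {x} {y} {z} p e) = subst (λ k → Walk G k z x) (+-comm ℓ 1)
    (walk-trans (snoc nil (trans (adj-sym G z y) e)) (walk-sym p))

  -- Every edge switches sides. Hence the parity prescribed at a node by continuing a height along a
  -- walk depends only on the endpoints.
  walk-side : ((side , _) : Bipartite G) → ∀ {ℓ x y} → Walk G ℓ x y → side y ≡ side x xor odd ℓ
  walk-side _ nil = sym (xor-identityʳ _)
  walk-side B@(side , bip) (snoc {ℓ} {x} {y} {z} p e) = begin
    side z                 ≡⟨ ¬-not (bip y z e ∘ sym) ⟩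
    not (side y)           ≡⟨ cong not (walk-side B p) ⟩
    not (side x xor odd ℓ) ≡⟨ not-distribʳ-xor (side x) (odd ℓ) ⟩
    side x xor odd (suc ℓ) ∎
    where open ≡-Reasoning

  walk⇒inBall : ∀ {ℓ k x y} → Walk G ℓ x y → ℓ ≤ k → T (inBall G k x y)
  walk⇒inBall {k = zero}  nil _ = fromWitness refl
  walk⇒inBall {k = suc k} nil _ = Equivalence.from T-∨ (inj₁ (walk⇒inBall {k = k} nil z≤n))
  walk⇒inBall {k = suc k} (snoc {y = y} p e) (s≤s ℓ≤k) = Equivalence.from T-∨ (inj₂
    (any⁺ _ (lose (∈-allFin y)
      (Equivalence.from T-∧ (walk⇒inBall p ℓ≤k , Equivalence.from T-≡ e)))))

  walkEnds-sound : ∀ ℓ {v x} → x ∈ walkEnds (adj G) ℓ v → Walk G ℓ v x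
  walkEnds-sound zero    (here refl) = nil
  walkEnds-sound (suc ℓ) {v} x∈ with find (∈-concatMap⁻ (neighbors (adj G)) {xs = walkEnds (adj G) ℓ v} x∈)
  ... | y , y∈ , x∈N = snoc (walkEnds-sound ℓ y∈)
    (proj₂ (∈-filter⁻ (λ z → adj G y z Bool.≟ true) {xs = allFin n} x∈N))

  walkEnds-complete : ∀ {ℓ v x} → Walk G ℓ v x → x ∈ walkEnds (adj G) ℓ v
  walkEnds-complete nil = here refl
  walkEnds-complete (snoc {y = y} {z} p e) = ∈-concatMap⁺ (neighbors (adj G))
    (lose (walkEnds-complete p) (∈-filter⁺ (λ x → adj G y x Bool.≟ true) (∈-allFin z) e))

  walksFrom-sound : ∀ {r v x ℓ} → (x , ℓ) ∈ walksFrom (adj G) r v → ℓ ≤ r × Walk G ℓ v x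
  walksFrom-sound {r} {v} p∈
    with find (∈-concatMap⁻ (λ ℓ → map (_, ℓ) (walkEnds (adj G) ℓ v)) {xs = upTo (suc r)} p∈)
  ... | ℓ , ℓ∈ , p∈ℓ with ∈-map⁻ (_, ℓ) p∈ℓ
  ... | x , x∈ , refl = s≤s⁻¹ (∈-upTo⁻ ℓ∈) , walkEnds-sound ℓ x∈

  walksFrom-complete : ∀ {r v x ℓ} → ℓ ≤ r → Walk G ℓ v x → (x , ℓ) ∈ walksFrom (adj G) r v
  walksFrom-complete {v = v} {ℓ = ℓ} ℓ≤r p = ∈-concatMap⁺ (λ k → map (_, k) (walkEnds (adj G) k v))
    (lose (∈-upTo⁺ (s≤s ℓ≤r)) (∈-map⁺ (_, ℓ) (walkEnds-complete p)))

-- Locality: walk data computed from the visible graph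

module _ {n} (G : Graph n) (r : ℕ) {vs : List (Fin n)} {v} (v∈vs : v ∈ vs) where

  private
    Γ = visibleAdj G r vs

  walk⇒visible : ∀ {ℓ x} → ℓ ≤ r → Walk G ℓ v x → T (visible G r vs x)
  walk⇒visible ℓ≤r p = any⁺ _ (lose v∈vs (walk⇒inBall p ℓ≤r))

  -- An edge is visible only if both of its ends are, and the far end may be one step further from
  -- `v`; hence `suc ℓ ≤ r`.
  neighbors-visible : ∀ {ℓ x} → suc ℓ ≤ r → Walk G ℓ v x → neighbors Γ x ≡ neighbors (adj G) x
  neighbors-visible {x = x} ℓ<r p = filter-≐ _ _ (to , from) (allFin n)
    where
    to : ∀ {y} → Γ x y ≡ true → adj G x y ≡ true
    to {y} e = Equivalence.to T-≡ (proj₂ (Equivalence.to (T-∧ {visible G r vs y})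
      (proj₂ (Equivalence.to (T-∧ {visible G r vs x}) (Equivalence.from T-≡ e)))))
    from : ∀ {y} → adj G x y ≡ true → Γ x y ≡ true
    from e = Equivalence.to T-≡ (Equivalence.from T-∧
      ( walk⇒visible (<⇒≤ ℓ<r) p
      , Equivalence.from T-∧ (walk⇒visible ℓ<r (snoc p e) , Equivalence.from T-≡ e)))

  walkEnds-visible : ∀ ℓ → ℓ ≤ r → walkEnds Γ ℓ v ≡ walkEnds (adj G) ℓ v
  walkEnds-visible zero    _   = refl
  walkEnds-visible (suc ℓ) ℓ<r = trans
    (cong (concatMap (neighbors Γ)) (walkEnds-visible ℓ (<⇒≤ ℓ<r)))
    (cong concat (map-cong-local
      (All.tabulate (λ x∈ → neighbors-visible ℓ<r (walkEnds-sound ℓ x∈)))))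

  -- Walks of length at most `r` from a revealed node never leave its ball, so every later view
  -- yields the same walk data for that node.
  walksFrom-visible : walksFrom Γ r v ≡ walksFrom (adj G) r v
  walksFrom-visible = cong concat (map-cong-local (All.tabulate λ {ℓ} ℓ∈ →
    cong (map (_, ℓ)) (walkEnds-visible ℓ (s≤s⁻¹ (∈-upTo⁻ ℓ∈)))))

run-cong : ∀ {n} (near near′ : Fin n → Ball n) s vs →
           (∀ {v} → v ∈ vs → near v ≡ near′ v) → run near s vs ≡ run near′ s vs
run-cong near near′ s []       _  = refl
run-cong near near′ s (v ∷ vs) eq = trans
  (cong (λ s′ → run near s′ vs) (cong (λ B → step B s v) (eq (here refl))))
  (run-cong near near′ (step (near′ v) s v) vs (eq ∘ there))

-- The invariant

module Correctness {n} (G : Graph n) (bipartite : Bipartite G) (r : ℕ) where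

  side : Fin n → Bool
  side = proj₁ bipartite

  -- Constant on a group when the parities of its heights follow the bipartition, up to a flip
  -- common to the group.
  sign : Entry n → Bool
  sign e = odd (height e) xor side (node e)

  record Invariant (s : List (Entry n)) : Set where
    field
      consistent : ∀ {e f} → e ∈ s → f ∈ s → label e ≡ label f → sign e ≡ sign f
      lipschitz  : ∀ {e f ℓ} → e ∈ s → f ∈ s → ℓ ≤ r → Walk G ℓ (node e) (node f) →
                   height e ≤ height f + ℓ
      closed     : ∀ {e f ℓ} → e ∈ s → f ∈ s → ℓ ≤ r → Walk G ℓ (node e) (node f) →
                   label e ≡ label f
      -- Here `a` accounts for lifts: each one adds 3 to the height and doubles the guaranteed group
      -- size.
      small      : ∀ {e} → e ∈ s →
                   ∃[ a ] height e ≤ 1 + 3 * a × 2 ^ a ≤ groupSize s (label e)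
      labelled   : ∀ {e} → e ∈ s → label e < length s

  Invariant-[] : Invariant []
  Invariant-[] = record
    { consistent = λ (); lipschitz = λ (); closed = λ (); small = λ (); labelled = λ () }

  module _ (N : ℕ) (radius≤r : radius N ≤ r) {s} (inv : Invariant s) (length<N : length s < N)
           (v : Fin n) (B : Ball n)
           (B-sound : ∀ {x ℓ} → (x , ℓ) ∈ B → ℓ ≤ r × Walk G ℓ v x)
           (B-complete : ∀ {x ℓ} → ℓ ≤ r → Walk G ℓ v x → (x , ℓ) ∈ B) where

    open Invariant inv
    open Step B s hiding (step)

    -- The sign of an entry at `v` whose height has the parity asked for by the unlifted class.
    target : Bool
    target = not shifted xor side v

    -- Some member of the group has a walk to `v` that realizes parity `b`; `walk-side` computes its
    -- sign, and `consistent` carries it to the whole group.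
    Touch⇒sign : ∀ {e b} → e ∈ s → Touch b (label e) → sign e ≡ b xor side v
    Touch⇒sign {e} e∈ t with find t
    ... | f , f∈ , f≡e , t′ with find t′
    ... | (.(node f) , ℓ) , p∈ , refl , refl = begin
      sign e                                       ≡⟨ consistent e∈ f∈ (sym f≡e) ⟩
      odd (height f) xor side (node f)             ≡⟨ cong (odd (height f) xor_) (walk-side bipartite (proj₂ (B-sound p∈))) ⟩
      odd (height f) xor (side v xor odd ℓ)        ≡⟨ xor-shuffle (odd (height f)) (side v) (odd ℓ) ⟩
      (odd (height f) xor odd ℓ) xor side v        ≡⟨ cong (_xor side v) (sym (odd-+ (height f) ℓ)) ⟩
      odd (height f + ℓ) xor side v                ∎
      where open ≡-Reasoning

    -- A group has a single sign, which determines `b`; so no group lies in both classes.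
    Touch-unique : ∀ {e b c} → e ∈ s → Touch b (label e) → Touch c (label e) → b ≡ c
    Touch-unique e∈ t u = xor-cancelʳ (side v) (trans (sym (Touch⇒sign e∈ t)) (Touch⇒sign e∈ u))

    -- A lift by 3 flips the sign of the `shifted` class, and the other class has the target sign
    -- already. So all touching groups can be merged.
    Touch⇒target : ∀ {e b} → e ∈ s → Touch b (label e) → sign (update e) ≡ target
    Touch⇒target {e} {b} e∈ t with lift-view (label e)
    ... | inj₁ (t′ , eq) = begin
      odd (lift (label e) + height e) xor side (node e) ≡⟨ cong (λ k → odd (k + height e) xor side (node e)) eq ⟩
      not (not (not (odd (height e)))) xor side (node e) ≡⟨ cong (_xor side (node e)) (not-involutive (not (odd (height e)))) ⟩
      not (odd (height e)) xor side (node e)            ≡⟨ sym (not-distribˡ-xor (odd (height e)) _) ⟩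
      not (sign e)                                      ≡⟨ cong not (Touch⇒sign e∈ t′) ⟩
      not (shifted xor side v)                          ≡⟨ not-distribˡ-xor shifted (side v) ⟩
      target                                            ∎
      where open ≡-Reasoning
    ... | inj₂ (¬t′ , eq) = begin
      odd (lift (label e) + height e) xor side (node e) ≡⟨ cong (λ k → odd (k + height e) xor side (node e)) eq ⟩
      sign e                                            ≡⟨ Touch⇒sign e∈ t ⟩
      b xor side v                                      ≡⟨ cong (_xor side v) (¬-not λ b≡ → ¬t′ (subst (λ c → Touch c (label e)) b≡ t)) ⟩
      target                                            ∎
      where open ≡-Reasoning

    near⇒Touch : ∀ {e ℓ} → e ∈ s → ℓ ≤ r → Walk G ℓ v (node e) →
                 Touch (odd (height e + ℓ)) (label e)
    near⇒Touch e∈ ℓ≤r p = lose e∈ (refl , lose (B-complete ℓ≤r p) (refl , refl))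

    near⇒fresh : ∀ {e ℓ} → e ∈ updated → ℓ ≤ r → Walk G ℓ v (node e) → label e ≡ fresh
    near⇒fresh e∈ ℓ≤r p with ∈-map⁻ update e∈
    ... | _ , e₀∈ , refl = Touch⇒fresh (near⇒Touch e₀∈ ℓ≤r p)

    near⇒odd : ∀ {e ℓ} → e ∈ updated → ℓ ≤ r → Walk G ℓ v (node e) →
               odd (height e + ℓ) ≡ not shifted
    near⇒odd {ℓ = ℓ} e∈ ℓ≤r p with ∈-map⁻ update e∈
    ... | e₀ , e₀∈ , refl = xor-cancelʳ (side v) (begin
      odd (h + ℓ) xor side v          ≡⟨ cong (_xor side v) (odd-+ h ℓ) ⟩
      (odd h xor odd ℓ) xor side v    ≡⟨ sym (xor-shuffle (odd h) (side v) (odd ℓ)) ⟩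
      odd h xor (side v xor odd ℓ)    ≡⟨ cong (odd h xor_) (sym (walk-side bipartite p)) ⟩
      sign (update e₀)                ≡⟨ Touch⇒target e₀∈ (near⇒Touch e₀∈ ℓ≤r p) ⟩
      target                          ∎)
      where
      open ≡-Reasoning
      h = height (update e₀)

    -- By `closed` the two entries share a label, so they receive the same lift.
    updated-lipschitz : ∀ {e f ℓ} → e ∈ updated → f ∈ updated → ℓ ≤ r →
                        Walk G ℓ (node e) (node f) → height e ≤ height f + ℓ
    updated-lipschitz {ℓ = ℓ} e∈ f∈ ℓ≤r p with ∈-map⁻ update e∈ | ∈-map⁻ update f∈
    ... | e₀ , e₀∈ , refl | f₀ , f₀∈ , refl = begin
      lift (label e₀) + height e₀       ≡⟨ cong (λ a → lift a + height e₀) (closed e₀∈ f₀∈ ℓ≤r p) ⟩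
      lift (label f₀) + height e₀       ≤⟨ +-monoʳ-≤ (lift (label f₀)) (lipschitz e₀∈ f₀∈ ℓ≤r p) ⟩
      lift (label f₀) + (height f₀ + ℓ) ≡⟨ sym (+-assoc (lift (label f₀)) (height f₀) ℓ) ⟩
      lift (label f₀) + height f₀ + ℓ   ∎
      where open ≤-Reasoning

    updated-closed : ∀ {e f ℓ} → e ∈ updated → f ∈ updated → ℓ ≤ r →
                     Walk G ℓ (node e) (node f) → label e ≡ label f
    updated-closed e∈ f∈ ℓ≤r p with ∈-map⁻ update e∈ | ∈-map⁻ update f∈
    ... | e₀ , e₀∈ , refl | f₀ , f₀∈ , refl = cong relabel (closed e₀∈ f₀∈ ℓ≤r p)

    groupSize-updated : ∀ a → groupSize s a ≤ groupSize updated (relabel a)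
    groupSize-updated a = length-filter-map-≤ (λ e → label e ℕ.≟ a)
      (λ e → label e ℕ.≟ relabel a) update s (λ _ → cong relabel)

    groupSize≤weight : ∀ {b a} → Touch b a → groupSize s a ≤ weight b
    groupSize≤weight {b} {a} t = subst (λ xs → groupSize s a ≤ length (filter (λ e → touch? b (label e)) xs))
      (map-id s)
      (length-filter-map-≤ (λ e → label e ℕ.≟ a) (λ e → touch? b (label e)) id s
        λ _ eq → subst (Touch b) (sym eq) t)

    weights≤groupSize : weight shifted + weight (not shifted) ≤ groupSize updated fresh
    weights≤groupSize = length-filter-disjoint-≤
      (λ e → touch? shifted (label e)) (λ e → label e ℕ.≟ fresh) update
      (λ e → touch? (not shifted) (label e)) s
      (λ e∈ t u → not-¬ refl (Touch-unique e∈ t u))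
      (λ _ → Touch⇒fresh) (λ _ → Touch⇒fresh)

    -- A lifted group lies in the lighter class, so the other class weighs at least as much as that
    -- group. Both end up under `fresh`, which doubles the size bound and pays for the 3.
    updated-small : ∀ {e} → e ∈ updated →
                    ∃[ a ] height e ≤ 1 + 3 * a × 2 ^ a ≤ groupSize updated (label e)
    updated-small e∈ with ∈-map⁻ update e∈
    ... | e₀ , e₀∈ , refl with small e₀∈ | lift-view (label e₀)
    ... | a , h≤ , 2^a≤ | inj₂ (_ , eq) = a ,
      subst (λ k → k + height e₀ ≤ 1 + 3 * a) (sym eq) h≤ ,
      ≤-trans 2^a≤ (groupSize-updated (label e₀))
    ... | a , h≤ , 2^a≤ | inj₁ (t , eq) = suc a , lifted≤ , doubled
      where
      open ≤-Reasoning
      lifted≤ : lift (label e₀) + height e₀ ≤ 1 + 3 * suc a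
      lifted≤ = begin
        lift (label e₀) + height e₀ ≡⟨ cong (_+ height e₀) eq ⟩
        3 + height e₀               ≤⟨ +-monoʳ-≤ 3 h≤ ⟩
        3 + (1 + 3 * a)             ≡⟨ cong suc (sym (*-suc 3 a)) ⟩
        1 + 3 * suc a               ∎
      group≤ : 2 ^ a ≤ weight shifted
      group≤ = ≤-trans 2^a≤ (groupSize≤weight t)
      doubled : 2 ^ suc a ≤ groupSize updated (relabel (label e₀))
      doubled = begin
        2 ^ a + (2 ^ a + 0)                   ≡⟨ cong (2 ^ a +_) (+-identityʳ (2 ^ a)) ⟩
        2 ^ a + 2 ^ a                         ≤⟨ +-mono-≤ group≤ (≤-trans group≤ shifted-lighter) ⟩
        weight shifted + weight (not shifted) ≤⟨ weights≤groupSize ⟩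
        groupSize updated fresh               ≡⟨ cong (groupSize updated) (sym (Touch⇒fresh t)) ⟩
        groupSize updated (relabel (label e₀)) ∎

    -- A group has at most `N` members, so `2 ^ a ≤ N` and `a` is at most the logarithm of `N`.
    updated≤r : ∀ {e} → e ∈ updated → height e ≤ r
    updated≤r {e} e∈ with updated-small e∈
    ... | a , h≤ , 2^a≤ = ≤-trans h≤ (≤-trans (s≤s (*-monoʳ-≤ 3 a≤)) radius≤r)
      where
      open ≤-Reasoning
      a≤ : a ≤ ⌊log₂ N ⌋
      a≤ = begin
        a              ≡⟨ sym (⌊log₂[2^n]⌋≡n a) ⟩
        ⌊log₂ 2 ^ a ⌋  ≤⟨ ⌊log₂⌋-mono-≤ (begin
          2 ^ a                        ≤⟨ 2^a≤ ⟩
          groupSize updated (label e)  ≤⟨ length-filter (λ f → label f ℕ.≟ label e) updated ⟩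
          length updated               ≡⟨ length-map update s ⟩
          length s                     ≤⟨ <⇒≤ length<N ⟩
          N                            ∎) ⟩
        ⌊log₂ N ⌋      ∎

    odd-newHeight : odd newHeight ≡ not shifted
    odd-newHeight with newHeight-sel
    ... | inj₁ eq = trans (cong odd eq) (odd-bit (not shifted))
    ... | inj₂ (e , ℓ , e∈ , p∈ , eq) with ≤-total ℓ (height e) | B-sound p∈
    ... | inj₁ ℓ≤h | ℓ≤r , p = trans (cong odd eq) (trans (odd-∸ ℓ≤h) (near⇒odd e∈ ℓ≤r p))
    -- If the subtraction truncates, the maximum is 0; the default value is then 0 too, so the
    -- required parity is even.
    ... | inj₂ h≤ℓ | _ = trans (cong odd newHeight≡0)
      (bit≤0 (subst (bit (not shifted) ≤_) newHeight≡0 bit≤newHeight))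
      where
      newHeight≡0 : newHeight ≡ 0
      newHeight≡0 = trans eq (m≤n⇒m∸n≡0 h≤ℓ)
      bit≤0 : ∀ {b} → bit b ≤ 0 → false ≡ b
      bit≤0 {false} _ = refl

    height≤newHeight : ∀ {e ℓ} → e ∈ updated → ℓ ≤ r → Walk G ℓ v (node e) →
                       height e ≤ newHeight + ℓ
    height≤newHeight {e} {ℓ} e∈ ℓ≤r p = begin
      height e             ≤⟨ m≤n+m∸n (height e) ℓ ⟩
      ℓ + (height e ∸ ℓ)   ≤⟨ +-monoʳ-≤ ℓ (descent≤newHeight e∈ (B-complete ℓ≤r p)) ⟩
      ℓ + newHeight        ≡⟨ +-comm ℓ newHeight ⟩
      newHeight + ℓ        ∎
      where open ≤-Reasoning

    -- Walks longer than r impose no constraint, because no height exceeds r.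
    newHeight≤height : ∀ {e ℓ} → e ∈ updated → ℓ ≤ r → Walk G ℓ v (node e) →
                       newHeight ≤ height e + ℓ
    newHeight≤height {e} {ℓ} e∈ ℓ≤r p with newHeight-sel
    -- The default value is the least number of its parity, and `height e + ℓ` has that parity.
    ... | inj₁ eq = subst (_≤ height e + ℓ)
      (trans (cong bit (near⇒odd e∈ ℓ≤r p)) (sym eq)) (bit-odd≤ (height e + ℓ))
    ... | inj₂ (f , k , f∈ , q∈ , eq) = subst (_≤ height e + ℓ) (sym eq)
      (m≤n+o⇒m∸n≤o (height f) k (subst (height f ≤_) regroup f≤))
      where
      regroup : height e + (ℓ + k) ≡ k + (height e + ℓ)
      regroup = trans (sym (+-assoc (height e) ℓ k)) (+-comm (height e + ℓ) k)
      f≤ : height f ≤ height e + (ℓ + k)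
      f≤ with ≤-total (ℓ + k) r
      ... | inj₁ ≤r = updated-lipschitz f∈ e∈ ≤r (walk-trans (walk-sym (proj₂ (B-sound q∈))) p)
      ... | inj₂ r≤ = ≤-trans (updated≤r f∈) (≤-trans r≤ (m≤n+m (ℓ + k) (height e)))

    new : Entry n
    new = entry v fresh newHeight

    -- Separates the merged group from the entries that the step leaves unchanged. Old labels are
    -- below `fresh`, so the two kinds never share a label.
    status : ∀ {e} → e ∈ step B s v → (label e ≡ fresh × sign e ≡ target) ⊎ e ∈ s
    status (here refl) = inj₁ (refl , cong (_xor side v) odd-newHeight)
    status (there e∈) with ∈-map⁻ update e∈
    ... | e₀ , e₀∈ , refl with relabel-view (label e₀)
    ... | inj₁ ((b , t) , eq) = inj₁ (eq , Touch⇒target e₀∈ t)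
    ... | inj₂ (¬t , eq) with lift-view (label e₀)
    ... | inj₁ (t , _) = contradiction t (¬t shifted)
    ... | inj₂ (_ , eq′) = inj₂ (subst (_∈ s)
      (sym (cong₂ (entry (node e₀)) eq (cong (_+ height e₀) eq′))) e₀∈)

    groupSize-step : ∀ a → groupSize updated a ≤ groupSize (step B s v) a
    groupSize-step a = length-filter-∷-≤ (λ e → label e ℕ.≟ a) new updated

    1≤groupSize : 1 ≤ groupSize (step B s v) fresh
    1≤groupSize = ∈-length (∈-filter⁺ (λ e → label e ℕ.≟ fresh) {xs = step B s v} (here refl) refl)

    Invariant-step : Invariant (step B s v)
    Invariant-step = record
      { consistent = consistent′ ; lipschitz = lipschitz′ ; closed = closed′
      ; small = small′ ; labelled = labelled′ }
      where
      consistent′ : ∀ {e f} → e ∈ step B s v → f ∈ step B s v → label e ≡ label f → sign e ≡ sign f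
      consistent′ e∈ f∈ eq with status e∈ | status f∈
      ... | inj₁ (_ , p)  | inj₁ (_ , q)  = trans p (sym q)
      ... | inj₂ e∈s      | inj₂ f∈s      = consistent e∈s f∈s eq
      ... | inj₁ (le , _) | inj₂ f∈s      = contradiction (trans (sym eq) le) (<⇒≢ (labelled f∈s))
      ... | inj₂ e∈s      | inj₁ (lf , _) = contradiction (trans eq lf) (<⇒≢ (labelled e∈s))

      lipschitz′ : ∀ {e f ℓ} → e ∈ step B s v → f ∈ step B s v → ℓ ≤ r →
                   Walk G ℓ (node e) (node f) → height e ≤ height f + ℓ
      lipschitz′ (here refl) (here refl) _   _ = m≤m+n newHeight _
      lipschitz′ (here refl) (there f∈)  ℓ≤r p = newHeight≤height f∈ ℓ≤r p
      lipschitz′ (there e∈)  (here refl) ℓ≤r p = height≤newHeight e∈ ℓ≤r (walk-sym p)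
      lipschitz′ (there e∈)  (there f∈)  ℓ≤r p = updated-lipschitz e∈ f∈ ℓ≤r p

      closed′ : ∀ {e f ℓ} → e ∈ step B s v → f ∈ step B s v → ℓ ≤ r →
                Walk G ℓ (node e) (node f) → label e ≡ label f
      closed′ (here refl) (here refl) _   _ = refl
      closed′ (here refl) (there f∈)  ℓ≤r p = sym (near⇒fresh f∈ ℓ≤r p)
      closed′ (there e∈)  (here refl) ℓ≤r p = near⇒fresh e∈ ℓ≤r (walk-sym p)
      closed′ (there e∈)  (there f∈)  ℓ≤r p = updated-closed e∈ f∈ ℓ≤r p

      small′ : ∀ {e} → e ∈ step B s v →
               ∃[ a ] height e ≤ 1 + 3 * a × 2 ^ a ≤ groupSize (step B s v) (label e)
      small′ {e} (there e∈) with updated-small e∈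
      ... | a , h≤ , 2^a≤ = a , h≤ , ≤-trans 2^a≤ (groupSize-step (label e))
      small′ (here refl) with newHeight-sel
      -- A starting height is at most 1, and the new node alone gives group size `2 ^ 0`.
      ... | inj₁ eq = 0 , subst (_≤ 1) (sym eq) (bit≤1 (not shifted)) , 1≤groupSize
      -- The new height is at most that of `f`, which is in the same group, so the witness of `f`
      -- serves again.
      ... | inj₂ (f , k , f∈ , q∈ , eq) with updated-small f∈ | B-sound q∈
      ... | a , h≤ , 2^a≤ | k≤r , q = a ,
        ≤-trans (≤-reflexive eq) (≤-trans (m∸n≤m (height f) k) h≤) ,
        ≤-trans 2^a≤ (≤-trans (groupSize-step (label f))
          (≤-reflexive (cong (groupSize (step B s v)) (near⇒fresh f∈ k≤r q))))

      labelled′ : ∀ {e} → e ∈ step B s v → label e < length (step B s v)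
      labelled′ e∈ rewrite length-map update s with status e∈
      ... | inj₁ (eq , _) = s≤s (≤-reflexive eq)
      ... | inj₂ e∈s      = m≤n⇒m≤1+n (labelled e∈s)

  length-step : ∀ (B : Ball n) s v → length (step B s v) ≡ suc (length s)
  length-step B s v = cong suc (length-map (Step.update B s) s)

  -- `N` bounds present and future entries together, so each step starts with fewer than `N` of
  -- them.
  Invariant-run : ∀ N → radius N ≤ r → ∀ {s} vs → Invariant s → length s + length vs ≤ N →
                  Invariant (run (walksFrom (adj G) r) s vs)
  Invariant-run N r≥ []           inv _ = inv
  Invariant-run N r≥ {s} (v ∷ vs) inv ≤N = Invariant-run N r≥ vs
    (Invariant-step N r≥ inv (≤-trans (s≤s (m≤m+n (length s) (length vs))) ≤N′) v
      (walksFrom (adj G) r v) walksFrom-sound walksFrom-complete)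
    (subst (λ k → k + length vs ≤ N) (sym (length-step (walksFrom (adj G) r v) s v)) ≤N′)
    where
    ≤N′ : suc (length s) + length vs ≤ N
    ≤N′ = subst (_≤ N) (+-suc (length s) (length vs)) ≤N

  -- An edge is a walk of length 1, so its ends are in one group with heights at most 1 apart. Equal
  -- parities would give equal signs and hence equal sides.
  proper : ∀ {s e f} → 1 ≤ r → Invariant s → e ∈ s → f ∈ s → adj G (node e) (node f) ≡ true →
           color (height e) ≢ color (height f)
  proper {e = e} {f} 1≤r inv e∈ f∈ ef = color-separates
    (subst (height e ≤_) (+-comm (height f) 1) (lipschitz e∈ f∈ 1≤r p))
    (subst (height f ≤_) (+-comm (height e) 1) (lipschitz f∈ e∈ 1≤r (walk-sym p)))
    λ eq → proj₂ bipartite _ _ ef (xor-cancelˡ (odd (height e))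
      (trans (consistent e∈ f∈ (closed e∈ f∈ 1≤r p)) (cong (_xor side (node f)) (sym eq))))
    where
    open Invariant inv
    p = snoc nil ef

-- Later steps add only 0 or 3 to an existing height, so a color once output is never revised.
run-color : ∀ {n} (near : Fin n → Ball n) {s} vs {e} → e ∈ s →
  ∃[ f ] f ∈ run near s vs × node f ≡ node e × color (height f) ≡ color (height e)
run-color near []       e∈ = _ , e∈ , refl , refl
run-color near {s} (v ∷ vs) {e} e∈
  with run-color near vs (there {x = entry v fresh newHeight} (∈-map⁺ update e∈))
  where open Step (near v) s
... | f , f∈ , node≡ , color≡ =
  f , f∈ , node≡ , trans color≡ (Step.color-lift (near v) s (label e) (height e))

-- Prefixes

-- A recursive form of the index list behind `prefix`, in which last elements and initial segments
-- are found by induction.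
upToFin : ∀ {n} → Fin n → List (Fin n)
upToFin zero    = [ zero ]
upToFin (suc i) = zero ∷ map suc (upToFin i)

filter-map : ∀ {A C : Set} {P : C → Set} {Q : A → Set} (P? : Decidable P) (Q? : Decidable Q)
             (f : A → C) → (∀ {x} → P (f x) → Q x) → (∀ {x} → Q x → P (f x)) →
             ∀ xs → filter P? (map f xs) ≡ map f (filter Q? xs)
filter-map P? Q? f to from []       = refl
filter-map P? Q? f to from (x ∷ xs) with P? (f x) | Q? x | filter-map P? Q? f to from xs
... | yes _ | yes _ | ih = cong (f x ∷_) ih
... | no _  | no _  | ih = ih
... | yes p | no ¬q | _  = contradiction (to p) ¬q
... | no ¬p | yes q | _  = contradiction (from q) ¬p

filter-≤-allFin : ∀ {n} (i : Fin n) → filter (Fin._≤? i) (allFin n) ≡ upToFin i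
filter-≤-allFin {suc n} zero = cong (zero ∷_)
  (filter-none (Fin._≤? zero {n}) (All.tabulate⁺ {f = Fin.suc {n}} λ _ ()))
filter-≤-allFin {suc n} (suc i) = cong (zero ∷_) (begin
  filter (Fin._≤? suc i) (tabulate suc)        ≡⟨ cong (filter (Fin._≤? suc i)) (sym (map-tabulate id suc)) ⟩
  filter (Fin._≤? suc i) (map suc (allFin n))  ≡⟨ filter-map (Fin._≤? suc i) (Fin._≤? i) suc s≤s⁻¹ s≤s (allFin n) ⟩
  map suc (filter (Fin._≤? i) (allFin n))      ≡⟨ cong (map suc) (filter-≤-allFin i) ⟩
  map suc (upToFin i)                          ∎)
  where open ≡-Reasoning

upToFin-last : ∀ {n} (i : Fin n) → ∃[ js ] upToFin i ≡ js ∷ʳ i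
upToFin-last zero    = [] , refl
upToFin-last (suc i) with upToFin-last i
... | js , eq = zero ∷ map suc js , cong (zero ∷_) (trans (cong (map suc) eq) (map-++ suc js [ i ]))

upToFin-< : ∀ {n} {i j : Fin n} → i Fin.< j → ∃[ ks ] upToFin j ≡ upToFin i ++ ks
upToFin-< {i = zero}  {suc j} _   = map suc (upToFin j) , refl
upToFin-< {i = suc i} {suc j} i<j with upToFin-< (ℕ.s<s⁻¹ i<j)
... | ks , eq = map suc ks ,
  cong (zero ∷_) (trans (cong (map suc) eq) (map-++ suc (upToFin i) ks))

length-upToFin : ∀ {n} (i : Fin n) → length (upToFin i) ≤ n
length-upToFin zero    = s≤s z≤n
length-upToFin (suc i) = s≤s (≤-trans (≤-reflexive (length-map suc (upToFin i))) (length-upToFin i))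

module _ {n} (σ : Fin n → Fin n) where

  prefix≡ : ∀ i → prefix σ i ≡ map σ (upToFin i)
  prefix≡ i = cong (map σ) (filter-≤-allFin i)

  prefix-last : ∀ i → ∃[ vs ] prefix σ i ≡ vs ∷ʳ σ i
  prefix-last i with upToFin-last i
  ... | js , eq = map σ js , trans (prefix≡ i) (trans (cong (map σ) eq) (map-++ σ js [ i ]))

  prefix-< : ∀ {i j} → i Fin.< j → ∃[ ws ] prefix σ j ≡ prefix σ i ++ ws
  prefix-< {i} {j} i<j with upToFin-< i<j
  ... | ks , eq = map σ ks , (begin
    prefix σ j                     ≡⟨ prefix≡ j ⟩
    map σ (upToFin j)              ≡⟨ cong (map σ) eq ⟩
    map σ (upToFin i ++ ks)        ≡⟨ map-++ σ (upToFin i) ks ⟩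
    map σ (upToFin i) ++ map σ ks  ≡⟨ cong (_++ map σ ks) (sym (prefix≡ i)) ⟩
    prefix σ i ++ map σ ks         ∎)
    where open ≡-Reasoning

  length-prefix : ∀ i → length (prefix σ i) ≤ n
  length-prefix i = ≤-trans
    (≤-reflexive (trans (cong length (prefix≡ i)) (length-map σ (upToFin i))))
    (length-upToFin i)

-- Correctness of the outputs

module _ {n} (G : Graph n) (bipartite : Bipartite G) (σ : Fin n → Fin n) where

  open Correctness G bipartite (radius n)

  near : Fin n → Ball n
  near = walksFrom (adj G) (radius n)

  state : Fin n → List (Entry n)
  state i = run near [] (prefix σ i)

  output≡ : ∀ i → output algorithm radius G σ i ≡ headColor (state i)
  output≡ i = cong headColor (run-cong _ near [] (prefix σ i) (walksFrom-visible G (radius n)))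

  output-entry : ∀ i → ∃[ e ] e ∈ state i × node e ≡ σ i ×
                       color (height e) ≡ output algorithm radius G σ i
  output-entry i with prefix-last σ i
  ... | vs , eq = head , subst (head ∈_) (sym state≡) (here refl) , refl ,
                  sym (trans (output≡ i) (cong headColor state≡))
    where
    s = run near [] vs
    open Step (near (σ i)) s using (fresh; newHeight)
    head = entry (σ i) fresh newHeight
    state≡ : state i ≡ step (near (σ i)) s (σ i)
    state≡ = trans (cong (run near []) eq) (foldl-∷ʳ (λ s v → step (near v) s v) [] (σ i) vs)

  -- Both colors are compared in the state reached when the later node is revealed: the earlier
  -- entry survives there with its color, and the invariant applies to the pair.
  output-< : ∀ {i j} → i Fin.< j → adj G (σ i) (σ j) ≡ true →
             output algorithm radius G σ i ≢ output algorithm radius G σ j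
  output-< {i} {j} i<j ij with prefix-< σ i<j | output-entry i | output-entry j
  ... | ws , eq | e , e∈ , node-e , color-e | f , f∈ , node-f , color-f
    with run-color near ws e∈
  ... | e′ , e′∈ , node-e′ , color-e′ = λ out≡ →
    proper (s≤s z≤n) (Invariant-run n ≤-refl (prefix σ j) Invariant-[] (length-prefix σ j))
      (subst (e′ ∈_) (sym state≡) e′∈) f∈
      (trans (cong₂ (adj G) (trans node-e′ node-e) node-f) ij)
      (trans color-e′ (trans color-e (trans out≡ (sym color-f))))
    where
    state≡ : state j ≡ run near (state i) ws
    state≡ = trans (cong (run near []) eq) (foldl-++ (λ s v → step (near v) s v) [] (prefix σ i) ws)

algorithm-correct : Solves3ColBipartite algorithm radius
algorithm-correct n G bipartite σ _ i j ij with <-cmp i j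
... | tri< i<j _ _ = output-< G bipartite σ i<j ij
... | tri> _ _ j<i = output-< G bipartite σ j<i (trans (adj-sym G (σ j) (σ i)) ij) ∘ sym
... | tri≈ _ refl _ = contradiction (trans (sym ij) (irrefl G (σ i))) λ ()

theorem1p1 : Σ (ℕ → ℕ) λ T → IsOLog T × Σ Algorithm λ A → Solves3ColBipartite A T
theorem1p1 = radius , radius-IsOLog , algorithm , algorithm-correct
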